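{- The following four statements are equivalent: (1) there is a function $f$ such that for every integer $s\ge 1$, every $s$-stack graph has queue number at most $f(s)$; (2) there is a constant $C$ such that every $3$-stack graph has queue number at most $C$; (3) there is a constant $C$ such that every $1$-stack $1$-queue graph has queue number at most $C$; (4) there is a function $f$ such that for all integers $s,q\ge 1$, every $s$-stack $q$-queue graph has queue number at most $f(s,q)$. (The functions $f$ and constants $C$ in different items are not required to be related.)
   Context: All graphs are simple, undirected, finite, and have at least one edge. Let $G=(V,E)$ be a graph and $\sigma$ a total order of $V$ (a vertex order). Two edges cross in $\sigma$ if their endvertices can be named $(u,v)$ and $(x,y)$ so that $u<_\sigma x<_\sigma v<_\sigma y$. Two edges nest in $\sigma$ if their endvertices can be named $(u,v)$ and $(x,y)$ so that $u<_\sigma x<_\sigma y<_\sigma v$. A stack (with respect to $\sigma$) is a set of edges no two of which cross; a queue is a set of edges no two of which nest. An $s$-stack layout ($s\ge1$) of $G$ is a vertex order $\sigma$ together with a partition of $E$ into $s$ stacks; a $q$-queue layout ($q\ge 1$) is a vertex order together with a partition of $E$ into $q$ queues; an $s$-stack $q$-queue layout ($s,q\ge 1$) is a vertex order together with a partition of $E$ into $s$ stacks and $q$ queues. Parts of these partitions are allowed to be empty. An $s$-stack graph (respectively $s$-stack $q$-queue graph) is a graph admitting an $s$-stack (respectively $s$-stack $q$-queue) layout. The queue number $\mathrm{qn}(G)$ is the minimum $q$ such that $G$ admits a $q$-queue layout. -}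

module Defs where

open import Level using (0ℓ)
open import Data.Bool using (Bool; true; false; T; T?)
open import Data.Bool.Properties using (T-irrelevant)
open import Data.Empty using (⊥-elim)
open import Data.Fin using (Fin; zero; suc; combine; remQuot; finToFun; funToFin)
import Data.Fin as Fin
open import Data.Fin.Properties
  using (any?; all?; finToFun-funToFin; remQuot-combine; combine-injective; <-irrelevant)
import Data.Fin.Properties as Finₚ
open import Data.Nat using (ℕ; zero; suc; _*_; _^_; _≤_; z≤n; s≤s)
open import Data.Product using (∃; ∃₂; _×_; _,_; proj₁; proj₂; uncurry)
open import Data.Sum using (_⊎_; inj₁; inj₂)
open import Function using (_∘_)
open import Relation.Binary
  using (Rel; IsStrictTotalOrder; Tri; tri<; tri≈; tri>; Trichotomous)
import Relation.Binary as B
open import Relation.Binary.PropositionalEquality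
  using (_≡_; refl; sym; trans; cong; subst; isEquivalence)
open import Relation.Nullary using (Dec; yes; no; ¬_; ¬?; _×-dec_; _⊎-dec_; _→-dec_)
import Relation.Nullary.Decidable as Dec
open import Relation.Unary using (Pred; Decidable)

record Graph : Set where
  field
    order       : ℕ
    adj         : Fin order → Fin order → Bool
    symmetric   : ∀ u v → adj u v ≡ adj v u
    irreflexive : ∀ v → adj v v ≡ false
    nonempty    : ∃₂ λ u v → T (adj u v)

  Vertex : Set
  Vertex = Fin order

  -- Listing the endvertices in increasing index gives each undirected edge
  -- exactly one inhabitant; this listing is unrelated to any vertex order.
  record Edge : Set where
    constructor edge
    field
      src tgt  : Vertex
      src<tgt  : src Fin.< tgt
      adjacent : T (adj src tgt)

  Ends : Edge → Vertex → Vertex → Set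
  Ends e u v = (u ≡ Edge.src e × v ≡ Edge.tgt e) ⊎ (u ≡ Edge.tgt e × v ≡ Edge.src e)

module _ (G : Graph) where
  open Graph G

  record VertexOrder : Set₁ where
    infix 4 _≺_
    field
      _≺_                : Rel Vertex 0ℓ
      isStrictTotalOrder : IsStrictTotalOrder _≡_ _≺_

  module _ (_≺_ : Rel Vertex 0ℓ) where

    Cross : Rel Edge 0ℓ
    Cross e f = ∃₂ λ u v → ∃₂ λ x y →
      Ends e u v × Ends f x y × u ≺ x × x ≺ v × v ≺ y

    Nest : Rel Edge 0ℓ
    Nest e f = ∃₂ λ u v → ∃₂ λ x y →
      Ends e u v × Ends f x y × u ≺ x × x ≺ y × y ≺ v

    IsStack : Pred Edge 0ℓ → Set
    IsStack S = ∀ e f → S e → S f → ¬ Cross e f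

    IsQueue : Pred Edge 0ℓ → Set
    IsQueue S = ∀ e f → S e → S f → ¬ Nest e f

  -- A partition of the edges into k possibly empty parts is a map to Fin k.

  record StackLayout (s : ℕ) : Set₁ where
    field
      vertexOrder : VertexOrder
    open VertexOrder vertexOrder public
    field
      part   : Edge → Fin s
      stacks : ∀ i → IsStack _≺_ (λ e → part e ≡ i)

  record QueueLayout (q : ℕ) : Set₁ where
    field
      vertexOrder : VertexOrder
    open VertexOrder vertexOrder public
    field
      part   : Edge → Fin q
      queues : ∀ i → IsQueue _≺_ (λ e → part e ≡ i)

  record StackQueueLayout (s q : ℕ) : Set₁ where
    field
      vertexOrder : VertexOrder
    open VertexOrder vertexOrder public
    field
      part   : Edge → Fin s ⊎ Fin q
      stacks : ∀ i → IsStack _≺_ (λ e → part e ≡ inj₁ i)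
      queues : ∀ j → IsQueue _≺_ (λ e → part e ≡ inj₂ j)

  IsQueueNumber : ℕ → Set₁
  IsQueueNumber k =
    1 ≤ k × QueueLayout k × (∀ q → 1 ≤ q → QueueLayout q → k ≤ q)

-- The minimum exists constructively: giving each edge its own queue bounds it,
-- and having a q-queue layout is decidable by searching through all orders and
-- partitions, both coded as functions on Fin (order * order).

least : ∀ {ℓ} {P : ℕ → Set ℓ} → Decidable P → ∀ n → P n →
        ∃ λ k → P k × (∀ j → P j → k ≤ j)
least P? n p with P? 0
least P? n       p | yes p₀ = 0 , p₀ , λ _ _ → z≤n
least P? zero    p | no ¬p₀ = ⊥-elim (¬p₀ p)
least P? (suc n) p | no ¬p₀ with least (P? ∘ suc) n p
... | k , pk , min = suc k , pk , λ where
  zero    p₀ → ⊥-elim (¬p₀ p₀)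
  (suc j) pj → s≤s (min j pj)

module _ (G : Graph) where
  open Graph G

  edge-≡ : ∀ {e f : Edge} → Edge.src e ≡ Edge.src f → Edge.tgt e ≡ Edge.tgt f → e ≡ f
  edge-≡ {edge u v p a} {edge _ _ q b} refl refl
    rewrite <-irrelevant p q | T-irrelevant a b = refl

  allEdges? : ∀ {P : Pred Edge 0ℓ} → Decidable P → Dec (∀ e → P e)
  allEdges? {P} P? = Dec.map′
    (λ h e → h _ _ (Edge.src<tgt e) (Edge.adjacent e))
    (λ h u v p a → h (edge u v p a))
    (all? λ u → all? λ v → pair? u v)
    where
    pair? : ∀ u v → Dec (∀ p a → P (edge u v p a))
    pair? u v with u Fin.<? v | T? (adj u v)
    ... | no ¬p | _     = yes λ p → ⊥-elim (¬p p)
    ... | yes _ | no ¬a = yes λ _ a → ⊥-elim (¬a a)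
    ... | yes p | yes a = Dec.map′
      (λ h p′ a′ → subst P (edge-≡ refl refl) h) (λ h → h p a) (P? (edge u v p a))

  ends? : ∀ e u v → Dec (Ends e u v)
  ends? e u v = ((u Fin.≟ _) ×-dec (v Fin.≟ _)) ⊎-dec ((u Fin.≟ _) ×-dec (v Fin.≟ _))

  module _ {_≺_ : Rel Vertex 0ℓ} (_≺?_ : B.Decidable _≺_) where

    nest? : B.Decidable (Nest G _≺_)
    nest? e f = any? λ u → any? λ v → any? λ x → any? λ y →
      ends? e u v ×-dec ends? f x y ×-dec (u ≺? x) ×-dec (x ≺? y) ×-dec (y ≺? v)

    isStrictTotalOrder? : Dec (IsStrictTotalOrder _≡_ _≺_)
    isStrictTotalOrder? = Dec.map′
      (λ (tr , cmp) → record
        { isStrictPartialOrder = record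
          { isEquivalence = isEquivalence
          ; irrefl        = λ { {x} refl x≺x → irr (cmp x x) x≺x }
          ; trans         = λ {x} {y} {z} → tr x y z
          ; <-resp-≈      = (λ { refl p → p }) , (λ { refl p → p })
          }
        ; compare = cmp
        })
      (λ sto → (λ _ _ _ → IsStrictTotalOrder.trans sto) , IsStrictTotalOrder.compare sto)
      ( (all? λ x → all? λ y → all? λ z → (x ≺? y) →-dec (y ≺? z) →-dec (x ≺? z))
        ×-dec (all? λ x → all? λ y → tri? x y) )
      where
      irr : ∀ {x} → Tri (x ≺ x) (x ≡ x) (x ≺ x) → ¬ (x ≺ x)
      irr (tri< _ x≢x _) = ⊥-elim (x≢x refl)
      irr (tri≈ ¬p _ _)  = ¬p
      irr (tri> _ x≢x _) = ⊥-elim (x≢x refl)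

      tri? : ∀ x y → Dec (Tri (x ≺ y) (x ≡ y) (y ≺ x))
      tri? x y with x ≺? y | x Fin.≟ y | y ≺? x
      ... | yes p | no ¬q | no ¬r = yes (tri< p ¬q ¬r)
      ... | no ¬p | yes q | no ¬r = yes (tri≈ ¬p q ¬r)
      ... | no ¬p | no ¬q | yes r = yes (tri> ¬p ¬q r)
      ... | yes p | yes q | _     = no λ where
        (tri< _ ¬q _) → ¬q q
        (tri≈ ¬p _ _) → ¬p p
        (tri> ¬p _ _) → ¬p p
      ... | yes p | no _  | yes r = no λ where
        (tri< _ _ ¬r) → ¬r r
        (tri≈ ¬p _ _) → ¬p p
        (tri> ¬p _ _) → ¬p p
      ... | no _  | yes q | yes r = no λ where
        (tri< _ ¬q _) → ¬q q
        (tri≈ _ _ ¬r) → ¬r r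
        (tri> _ ¬q _) → ¬q q
      ... | no ¬p | no ¬q | no ¬r = no λ where
        (tri< p _ _) → ¬p p
        (tri≈ _ q _) → ¬q q
        (tri> _ _ r) → ¬r r

  decode : ∀ {m} → Fin (m ^ (order * order)) → Vertex → Vertex → Fin m
  decode c u v = finToFun c (combine u v)

  encode : ∀ {m} → (Vertex → Vertex → Fin m) → Fin (m ^ (order * order))
  encode f = funToFin (uncurry f ∘ remQuot order)

  decode-encode : ∀ {m} (f : Vertex → Vertex → Fin m) u v → decode (encode f) u v ≡ f u v
  decode-encode f u v = trans
    (finToFun-funToFin (uncurry f ∘ remQuot order) (combine u v))
    (cong (uncurry f) (remQuot-combine u v))

  CodedOrder : Fin (2 ^ (order * order)) → Rel Vertex 0ℓ
  CodedOrder c u v = decode c u v ≡ zero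

  CodedLayout : ∀ q → Fin (2 ^ (order * order)) → Fin (q ^ (order * order)) → Set
  CodedLayout q c d = IsStrictTotalOrder _≡_ (CodedOrder c) ×
    (∀ e f → colour e ≡ colour f → ¬ Nest G (CodedOrder c) e f)
    where
    colour : Edge → Fin q
    colour e = decode d (Edge.src e) (Edge.tgt e)

  codedLayout? : ∀ q c d → Dec (CodedLayout q c d)
  codedLayout? q c d =
    isStrictTotalOrder? ≺? ×-dec
    allEdges? λ e → allEdges? λ f → (_ Fin.≟ _) →-dec ¬? (nest? ≺? e f)
    where
    ≺? : B.Decidable (CodedOrder c)
    ≺? u v = decode c u v Fin.≟ zero

  fromCode : ∀ {q c d} → CodedLayout q c d → QueueLayout G q
  fromCode {c = c} {d} (sto , queue) = record
    { vertexOrder = record { _≺_ = CodedOrder c ; isStrictTotalOrder = sto }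
    ; part        = λ e → decode d (Edge.src e) (Edge.tgt e)
    ; queues      = λ i e f p q → queue e f (trans p (sym q))
    }

  toCode : ∀ {q} → QueueLayout G (suc q) → ∃₂ (CodedLayout (suc q))
  toCode {q} L = c , d ,
    record
      { isStrictPartialOrder = record
        { isEquivalence = isEquivalence
        ; irrefl        = λ x≡y p → O.irrefl x≡y (from p)
        ; trans         = λ p r → to (O.trans (from p) (from r))
        ; <-resp-≈      = (λ { refl p → p }) , (λ { refl p → p })
        }
      ; compare = cmp
      } ,
    λ e f eq (u , v , x , y , p , r , a , b , z) →
      queues _ e f (trans (sym (colour≡ e)) (trans eq (colour≡ f))) refl
        (u , v , x , y , p , r , from a , from b , from z)
    where
    open QueueLayout L
    module O = IsStrictTotalOrder isStrictTotalOrder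

    bit : ∀ {A : Set} → Dec A → Fin 2
    bit (yes _) = zero
    bit (no _)  = suc zero

    bit-yes : ∀ {A : Set} (A? : Dec A) → A → bit A? ≡ zero
    bit-yes (yes _) _ = refl
    bit-yes (no ¬a) a = ⊥-elim (¬a a)

    bit-zero : ∀ {A : Set} (A? : Dec A) → bit A? ≡ zero → A
    bit-zero (yes a) _ = a

    less : Vertex → Vertex → Fin 2
    less u v = bit (u O.<? v)

    c : Fin (2 ^ (order * order))
    c = encode less

    from : ∀ {u v} → CodedOrder c u v → u ≺ v
    from {u} {v} p = bit-zero (u O.<? v) (trans (sym (decode-encode less u v)) p)

    to : ∀ {u v} → u ≺ v → CodedOrder c u v
    to {u} {v} p = trans (decode-encode less u v) (bit-yes (u O.<? v) p)

    cmp : Trichotomous _≡_ (CodedOrder c)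
    cmp x y with O.compare x y
    ... | tri< p ¬q ¬r = tri< (to p) ¬q (¬r ∘ from)
    ... | tri≈ ¬p q ¬r = tri≈ (¬p ∘ from) q (¬r ∘ from)
    ... | tri> ¬p ¬q r = tri> (¬p ∘ from) ¬q (to r)

    colour : Vertex → Vertex → Fin (suc q)
    colour u v with u Fin.<? v | T? (adj u v)
    ... | yes p | yes a = part (edge u v p a)
    ... | yes _ | no _  = zero
    ... | no _  | _     = zero

    colour-part : ∀ e → colour (Edge.src e) (Edge.tgt e) ≡ part e
    colour-part (edge u v p a) with u Fin.<? v | T? (adj u v)
    ... | yes _ | yes _ = cong part (edge-≡ refl refl)
    ... | yes _ | no ¬a = ⊥-elim (¬a a)
    ... | no ¬p | _     = ⊥-elim (¬p p)

    d : Fin (suc q ^ (order * order))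
    d = encode colour

    colour≡ : ∀ e → decode d (Edge.src e) (Edge.tgt e) ≡ part e
    colour≡ e = trans (decode-encode colour (Edge.src e) (Edge.tgt e)) (colour-part e)

  queueLayout? : ∀ q → Dec (1 ≤ q × QueueLayout G q)
  queueLayout? zero    = no λ ()
  queueLayout? (suc q) = Dec.map′
    (λ (_ , _ , code) → s≤s z≤n , fromCode code)
    (λ (_ , L) → toCode L)
    (any? λ c → any? λ d → codedLayout? (suc q) c d)

  separateQueues : QueueLayout G (order * order)
  separateQueues = record
    { vertexOrder = record { _≺_ = Fin._<_ ; isStrictTotalOrder = Finₚ.<-isStrictTotalOrder }
    ; part        = λ e → combine (Edge.src e) (Edge.tgt e)
    ; queues      = λ i e f p q → notNested e f (trans p (sym q))
    }
    where
    notSelfNested : ∀ e → ¬ Nest G Fin._<_ e e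
    notSelfNested e (u , v , x , y , inj₁ (refl , _) , inj₁ (refl , _) , a , _) =
      Finₚ.<-irrefl refl a
    notSelfNested e (u , v , x , y , inj₂ (refl , _) , inj₂ (refl , _) , a , _) =
      Finₚ.<-irrefl refl a
    notSelfNested e (u , v , x , y , inj₁ (refl , refl) , inj₂ (refl , refl) , a , b , _) =
      Finₚ.<-asym a b
    notSelfNested e (u , v , x , y , inj₂ (refl , refl) , inj₁ (refl , refl) , a , b , _) =
      Finₚ.<-asym a b

    notNested : ∀ e f → combine (Edge.src e) (Edge.tgt e) ≡ combine (Edge.src f) (Edge.tgt f) →
                ¬ Nest G Fin._<_ e f
    notNested e f eq with combine-injective (Edge.src e) (Edge.tgt e) (Edge.src f) (Edge.tgt f) eq
    ... | p , q with edge-≡ {e} {f} p q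
    ... | refl = notSelfNested e

  1≤order² : 1 ≤ order * order
  1≤order² = inhabited (combine (proj₁ nonempty) (proj₁ nonempty))
    where
    inhabited : ∀ {n} → Fin n → 1 ≤ n
    inhabited {suc n} _ = s≤s z≤n

  abstract
    queueNumber : ∃ (IsQueueNumber G)
    queueNumber with least queueLayout? (order * order) (1≤order² , separateQueues)
    ... | k , (1≤k , L) , min = k , 1≤k , L , λ q 1≤q L′ → min q (1≤q , L′)

  qn : ℕ
  qn = proj₁ queueNumber

  qn-isQueueNumber : IsQueueNumber G qn
  qn-isQueueNumber = proj₂ queueNumber

BoundedOnStackGraphs : Set₁
BoundedOnStackGraphs =
  ∃ λ (f : ℕ → ℕ) → ∀ s → 1 ≤ s → ∀ G → StackLayout G s → qn G ≤ f s

BoundedOn3StackGraphs : Set₁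
BoundedOn3StackGraphs =
  ∃ λ (C : ℕ) → ∀ G → StackLayout G 3 → qn G ≤ C

BoundedOn1Stack1QueueGraphs : Set₁
BoundedOn1Stack1QueueGraphs =
  ∃ λ (C : ℕ) → ∀ G → StackQueueLayout G 1 1 → qn G ≤ C

BoundedOnStackQueueGraphs : Set₁
BoundedOnStackQueueGraphs =
  ∃ λ (f : ℕ → ℕ → ℕ) → ∀ s q → 1 ≤ s → 1 ≤ q →
    ∀ G → StackQueueLayout G s q → qn G ≤ f s q

{-# OPTIONS --safe #-}

-- Subdividing edges of G a bounded number of times does not change whether its
-- queue number is bounded: in a queue layout of the subdivision, two edges of G
-- whose paths use the same queues in the same directions cannot nest, because
-- each step of such paths preserves the order of their vertices.  It therefore
-- suffices to trade stacks and queues against each other in subdivisions, where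
-- chosen edges uv are replaced by paths of length three through a vertex near u
-- and a vertex near v, placed in a block beside the vertices of G:
--   * 4 + s stacks become 3 + s stacks;
--   * 3 stacks become 1 stack and 1 queue;
--   * a queue becomes 2 stacks.

module Submission where

open import Defs
open import Level using (0ℓ)
open import Data.Bool using (Bool; true; false; T; T?; if_then_else_)
import Data.Bool as Bool
import Data.Bool.Properties as Boolₚ
open import Data.Empty using (⊥; ⊥-elim)
open import Data.Fin using (Fin; zero; suc; inject≤; _↑ʳ_)
import Data.Fin as Fin
import Data.Fin.Properties as Finₚ
open import Data.Nat using (ℕ; zero; suc; _+_; _*_; _≤_; z≤n; s≤s)
open import Data.Product using (∃; _×_; _,_; proj₁; proj₂; swap)
open import Data.Product.Function.NonDependent.Propositional using (_×-↔_)
open import Data.Product.Properties using (,-injective)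
open import Data.Product.Relation.Binary.Lex.Strict using (×-Lex; ×-isStrictTotalOrder)
open import Data.Product.Relation.Binary.Pointwise.NonDependent using (Pointwise)
open import Data.Sum using (_⊎_; inj₁; inj₂; [_,_])
import Data.Sum as Sum
open import Data.Sum.Function.Propositional using (_⊎-↔_)
open import Data.Sum.Properties using (inj₁-injective; inj₂-injective)
open import Function using (_∘_; id; flip; _⇔_; _↔_; mk⇔; Inverse; Equivalence)
open import Function.Construct.Composition using (_↔-∘_)
open import Function.Construct.Identity using (↔-id)
open import Function.Definitions using (Injective)
open import Relation.Binary
  using (Rel; IsStrictTotalOrder; Decidable; Transitive; Trichotomous; Tri; tri<; tri≈; tri>)
open import Relation.Binary.PropositionalEquality
  using (_≡_; _≢_; refl; sym; trans; cong; subst; subst₂; isEquivalence)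
open import Relation.Binary.Structures.Biased using (isStrictTotalOrderᶜ)
import Relation.Binary.Construct.Flip.EqAndOrd as Flip
open import Relation.Nullary using (yes; no; ¬_; does; contradiction; _×-dec_)
open import Relation.Nullary.Decidable using (map′; dec-true; dec-false; does-⇔)

-- Layouts over arbitrary vertex and colour types

Adj : (G : Graph) → Rel (Graph.Vertex G) 0ℓ
Adj G u v = T (Graph.adj G u v)

-- Colours live on ordered pairs, symmetrically on adjacent ones, so an edge can be read from either
-- end without choosing a representative. An arbitrary vertex type lets a subdivision be laid out on
-- a sum type, and an empty `S` or `Q` gives pure queue or pure stack layouts.
record Layout {W : Set} (A : Rel W 0ℓ) (S Q : Set) : Set₁ where
  infix 4 _<_
  field
    _<_                : Rel W 0ℓ
    isStrictTotalOrder : IsStrictTotalOrder _≡_ _<_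
    colour             : W → W → S ⊎ Q
    colour-sym         : ∀ {a b} → A a b → colour a b ≡ colour b a
    noCross            : ∀ {a b c d i} → A a b → A c d →
                         colour a b ≡ inj₁ i → colour c d ≡ inj₁ i →
                         a < c → c < b → b < d → ⊥
    noNest             : ∀ {a b c d j} → A a b → A c d →
                         colour a b ≡ inj₂ j → colour c d ≡ inj₂ j →
                         a < c → c < d → d < b → ⊥
  module O = IsStrictTotalOrder isStrictTotalOrder

-- The equality on `X` is left general because lexicographic orders on products come with pointwise
-- equality instead of `_≡_`.
module _ {W X : Set} {_≈_ _<_ : Rel X 0ℓ} (f : W → X)
         (≈-refl : ∀ {a b} → a ≡ b → f a ≈ f b)
         (injective : ∀ {a b} → f a ≈ f b → a ≡ b) where

  isStrictTotalOrder-on : IsStrictTotalOrder _≈_ _<_ →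
                          IsStrictTotalOrder _≡_ (λ a b → f a < f b)
  isStrictTotalOrder-on O = isStrictTotalOrderᶜ record
    { isEquivalence = isEquivalence
    ; trans         = O.trans
    ; compare       = cmp
    }
    where
    module O = IsStrictTotalOrder O

    cmp : Trichotomous _≡_ (λ a b → f a < f b)
    cmp a b with O.compare (f a) (f b)
    ... | tri< lt ≉ ≯ = tri< lt (≉ ∘ ≈-refl) ≯
    ... | tri≈ ≮ eq ≯ = tri≈ ≮ (injective eq) ≯
    ... | tri> ≮ ≉ gt = tri> ≮ (≉ ∘ ≈-refl) gt

pullback : ∀ {W W′ : Set} {A : Rel W 0ℓ} {A′ : Rel W′ 0ℓ} {S Q : Set} (f : W′ → W) →
           Injective _≡_ _≡_ f → (∀ {a b} → A′ a b → A (f a) (f b)) →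
           Layout A S Q → Layout A′ S Q
pullback f inj hom L = record
  { _<_                = λ a b → f a < f b
  ; isStrictTotalOrder = isStrictTotalOrder-on f (cong f) inj isStrictTotalOrder
  ; colour             = λ a b → colour (f a) (f b)
  ; colour-sym         = colour-sym ∘ hom
  ; noCross            = λ p r → noCross (hom p) (hom r)
  ; noNest             = λ p r → noNest (hom p) (hom r)
  }
  where open Layout L

recolour : ∀ {W : Set} {A : Rel W 0ℓ} {S S′ Q Q′ : Set} (f : S → S′) (g : Q → Q′) →
           Injective _≡_ _≡_ f → Injective _≡_ _≡_ g →
           Layout A S Q → Layout A S′ Q′
recolour {S = S} {Q = Q} f g f-inj g-inj L = record
  { _<_                = _<_
  ; isStrictTotalOrder = isStrictTotalOrder
  ; colour             = λ a b → Sum.map f g (colour a b)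
  ; colour-sym         = cong (Sum.map f g) ∘ colour-sym
  ; noCross            = λ p r k l → let _ , k′ , l′ = stack k l in noCross p r k′ l′
  ; noNest             = λ p r k l → let _ , k′ , l′ = queue k l in noNest p r k′ l′
  }
  where
  open Layout L

  stack : ∀ {k l : S ⊎ Q} {i} → Sum.map f g k ≡ inj₁ i → Sum.map f g l ≡ inj₁ i →
          ∃ λ j → k ≡ inj₁ j × l ≡ inj₁ j
  stack {inj₁ j} {inj₁ j′} refl eq = j , refl , cong inj₁ (f-inj (inj₁-injective eq))

  queue : ∀ {k l : S ⊎ Q} {i} → Sum.map f g k ≡ inj₂ i → Sum.map f g l ≡ inj₂ i →
          ∃ λ j → k ≡ inj₂ j × l ≡ inj₂ j
  queue {inj₂ j} {inj₂ j′} refl eq = j , refl , cong inj₂ (g-inj (inj₂-injective eq))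

-- Graph layouts as `Layout`s, and bounds on the queue number

module _ (G : Graph) where
  open Graph G

  ends-unique : ∀ e f {u v} → Ends e u v → Ends f u v → e ≡ f
  ends-unique _ _ (inj₁ (refl , refl)) (inj₁ (p , q)) = edge-≡ G p q
  ends-unique _ _ (inj₂ (refl , refl)) (inj₂ (p , q)) = edge-≡ G q p
  ends-unique e f (inj₁ (refl , refl)) (inj₂ (refl , refl)) =
    ⊥-elim (Finₚ.<-asym (Edge.src<tgt e) (Edge.src<tgt f))
  ends-unique e f (inj₂ (refl , refl)) (inj₁ (refl , refl)) =
    ⊥-elim (Finₚ.<-asym (Edge.src<tgt e) (Edge.src<tgt f))

  ends-swap : ∀ e {u v} → Ends e u v → Ends e v u
  ends-swap _ = Sum.swap ∘ Sum.map swap swap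

  adjacent-≢ : ∀ {u v} → Adj G u v → u ≢ v
  adjacent-≢ p refl = subst T (irreflexive _) p

  adjacent-sym : ∀ {u v} → Adj G u v → Adj G v u
  adjacent-sym = subst T (symmetric _ _)

  ends-adjacent : ∀ e {u v} → Ends e u v → Adj G u v
  ends-adjacent e (inj₁ (refl , refl)) = Edge.adjacent e
  ends-adjacent e (inj₂ (refl , refl)) = adjacent-sym (Edge.adjacent e)

  edgeOn : ∀ {u v} → Adj G u v → ∃ λ e → Ends e u v
  edgeOn {u} {v} a with Finₚ.<-cmp u v
  ... | tri< u<v _ _ = edge u v u<v a , inj₁ (refl , refl)
  ... | tri≈ _ u≡v _ = ⊥-elim (adjacent-≢ a u≡v)
  ... | tri> _ _ v<u = edge v u v<u (adjacent-sym a) , inj₂ (refl , refl)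

  fromStackQueue : ∀ {s q} → StackQueueLayout G s q → Layout (Adj G) (Fin s) (Fin q)
  fromStackQueue {s} {q} L = record
    { _<_                = _≺_
    ; isStrictTotalOrder = isStrictTotalOrder
    ; colour             = colour
    ; colour-sym         = colour-sym
    ; noCross            = λ p r k l a b c →
        let e , E , k′ = colour-part p
            f , F , l′ = colour-part r
        in stacks _ e f (trans (sym k′) k) (trans (sym l′) l)
             (_ , _ , _ , _ , E , F , a , b , c)
    ; noNest             = λ p r k l a b c →
        let e , E , k′ = colour-part p
            f , F , l′ = colour-part r
        in queues _ e f (trans (sym k′) k) (trans (sym l′) l)
             (_ , _ , _ , _ , E , F , a , b , c)
    }
    where
    open StackQueueLayout L

    colour : Vertex → Vertex → Fin s ⊎ Fin q
    colour u v with T? (adj u v)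
    ... | yes a = part (proj₁ (edgeOn a))
    -- `Fin s ⊎ Fin q` could a priori be empty, so non-adjacent pairs borrow the colour of the edge
    -- given by `nonempty`.
    ... | no _  = part (proj₁ (edgeOn (proj₂ (proj₂ nonempty))))

    colour-part : ∀ {u v} → Adj G u v → ∃ λ e → Ends e u v × colour u v ≡ part e
    colour-part {u} {v} a with T? (adj u v)
    ... | yes a′ = let e , E = edgeOn a′ in e , E , refl
    ... | no ¬a  = ⊥-elim (¬a a)

    colour-sym : ∀ {u v} → Adj G u v → colour u v ≡ colour v u
    colour-sym {u} {v} a with colour-part a | colour-part (adjacent-sym a)
    ... | e , E , p | f , F , r =
      trans p (trans (cong part (ends-unique e f E (ends-swap f F))) (sym r))

  toStackQueue : ∀ {s q} → Layout (Adj G) (Fin s) (Fin q) → StackQueueLayout G s q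
  toStackQueue {s} {q} L = record
    { vertexOrder = record { _≺_ = _<_ ; isStrictTotalOrder = isStrictTotalOrder }
    ; part        = part
    ; stacks      = λ i e f k l (_ , _ , _ , _ , E , F , a , b , c) →
        noCross (ends-adjacent e E) (ends-adjacent f F)
                (trans (colour-part e E) k) (trans (colour-part f F) l) a b c
    ; queues      = λ i e f k l (_ , _ , _ , _ , E , F , a , b , c) →
        noNest (ends-adjacent e E) (ends-adjacent f F)
               (trans (colour-part e E) k) (trans (colour-part f F) l) a b c
    }
    where
    open Layout L

    part : Edge → Fin s ⊎ Fin q
    part e = colour (Edge.src e) (Edge.tgt e)

    colour-part : ∀ e {u v} → Ends e u v → colour u v ≡ part e
    colour-part e (inj₁ (refl , refl)) = refl
    colour-part e (inj₂ (refl , refl)) = sym (colour-sym (Edge.adjacent e))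

  fromStack : ∀ {s q} → StackLayout G s → StackQueueLayout G s q
  fromStack L = record
    { vertexOrder = vertexOrder
    ; part        = inj₁ ∘ part
    ; stacks      = λ i e f p r → stacks i e f (inj₁-injective p) (inj₁-injective r)
    ; queues      = λ _ _ _ ()
    }
    where open StackLayout L

  toStack : ∀ {s} → StackQueueLayout G s 0 → StackLayout G s
  toStack {s} L = record
    { vertexOrder = vertexOrder
    ; part        = fromInj ∘ part
    ; stacks      = λ i e f p r →
        stacks i e f (trans (fromInj-inj₁ (part e)) (cong inj₁ p))
                     (trans (fromInj-inj₁ (part f)) (cong inj₁ r))
    }
    where
    open StackQueueLayout L

    fromInj : Fin s ⊎ Fin 0 → Fin s
    fromInj = [ id , (λ ()) ]

    fromInj-inj₁ : ∀ k → k ≡ inj₁ (fromInj k)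
    fromInj-inj₁ (inj₁ _) = refl

  fromQueue : ∀ {q} → QueueLayout G q → StackQueueLayout G 0 q
  fromQueue L = record
    { vertexOrder = vertexOrder
    ; part        = inj₂ ∘ part
    ; stacks      = λ _ _ _ ()
    ; queues      = λ i e f p r → queues i e f (inj₂-injective p) (inj₂-injective r)
    }
    where open QueueLayout L

  toQueue : ∀ {q} → StackQueueLayout G 0 q → QueueLayout G q
  toQueue {q} L = record
    { vertexOrder = vertexOrder
    ; part        = fromInj ∘ part
    ; queues      = λ i e f p r →
        queues i e f (trans (fromInj-inj₂ (part e)) (cong inj₂ p))
                     (trans (fromInj-inj₂ (part f)) (cong inj₂ r))
    }
    where
    open StackQueueLayout L

    fromInj : Fin 0 ⊎ Fin q → Fin q
    fromInj = [ (λ ()) , id ]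

    fromInj-inj₂ : ∀ k → k ≡ inj₂ (fromInj k)
    fromInj-inj₂ (inj₂ _) = refl

  qn-≤ : ∀ {q} → Layout (Adj G) (Fin 0) (Fin q) → qn G ≤ q
  -- `IsQueueNumber` compares only with positive numbers of queues. Here `q` is positive because `G`
  -- has an edge, whose part lies in `Fin q`.
  qn-≤ {q} L = proj₂ (proj₂ (qn-isQueueNumber G)) q (inhabited Q.part) Q
    where
    Q : QueueLayout G q
    Q = toQueue (toStackQueue L)

    module Q = QueueLayout Q

    inhabited : ∀ {m} → (Edge → Fin m) → 1 ≤ m
    inhabited {zero}  part with () ← part (proj₁ (edgeOn (proj₂ (proj₂ nonempty))))
    inhabited {suc _} part = s≤s z≤n

  -- A layout with the minimum number of queues is padded with empty queues.
  queueLayout : ∀ {C} → qn G ≤ C → Layout (Adj G) (Fin 0) (Fin C)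
  queueLayout qn≤C =
    recolour id (λ i → inject≤ i qn≤C) id (Finₚ.inject≤-injective qn≤C qn≤C _ _)
      (fromStackQueue (fromQueue (proj₁ (proj₂ (qn-isQueueNumber G)))))

-- Subdivisions and their contraction

Step : Set → Set
Step Q = Bool × Q

-- Queues for the edges of G, given q queues for a subdivision: q for the kept
-- edges, and one for each sequence of directions and queues along the three
-- edges replacing a subdivided one.
contractedQueues : ℕ → ℕ
contractedQueues q = q + (2 * q) * ((2 * q) * (2 * q))

-- Each moved edge uv is subdivided twice: the division vertex next to u is
-- inj₂ (u , v), the one next to v is inj₂ (v , u).  Pairs that are not moved
-- edges are isolated vertices.
module Subdivision (G : Graph) (moved : Graph.Vertex G → Graph.Vertex G → Bool)
  (moved-sym : ∀ {u v} → Adj G u v → moved u v ≡ moved v u) where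
  open Graph G

  W : Set
  W = Vertex ⊎ (Vertex × Vertex)

  data SubAdj : Rel W 0ℓ where
    keep : ∀ {u v} → Adj G u v → moved u v ≡ false → SubAdj (inj₁ u) (inj₁ v)
    out  : ∀ {u v} → Adj G u v → moved u v ≡ true  → SubAdj (inj₁ u) (inj₂ (u , v))
    back : ∀ {u v} → Adj G u v → moved u v ≡ true  → SubAdj (inj₂ (u , v)) (inj₁ u)
    mid  : ∀ {u v} → Adj G u v → moved u v ≡ true  → SubAdj (inj₂ (u , v)) (inj₂ (v , u))

  subAdj-sym : ∀ {a b} → SubAdj a b → SubAdj b a
  subAdj-sym (keep p m) = keep (adjacent-sym G p) (trans (sym (moved-sym p)) m)
  subAdj-sym (out p m)  = back p m
  subAdj-sym (back p m) = out p m
  subAdj-sym (mid p m)  = mid (adjacent-sym G p) (trans (sym (moved-sym p)) m)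

  subAdj-≢ : ∀ {a b} → SubAdj a b → a ≢ b
  subAdj-≢ (keep p _) refl = adjacent-≢ G p refl
  subAdj-≢ (mid p _)  refl = adjacent-≢ G p refl

  subAdj? : Decidable SubAdj
  subAdj? (inj₁ u) (inj₁ v) = map′
    (λ (p , m) → keep p m) (λ { (keep p m) → p , m })
    (T? (adj u v) ×-dec (moved u v Boolₚ.≟ false))
  subAdj? (inj₁ u) (inj₂ (x , y)) = map′
    (λ { (refl , p , m) → out p m }) (λ { (out p m) → refl , p , m })
    ((u Fin.≟ x) ×-dec T? (adj x y) ×-dec (moved x y Boolₚ.≟ true))
  subAdj? (inj₂ (x , y)) (inj₁ u) = map′
    (λ { (refl , p , m) → back p m }) (λ { (back p m) → refl , p , m })
    ((u Fin.≟ x) ×-dec T? (adj x y) ×-dec (moved x y Boolₚ.≟ true))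
  subAdj? (inj₂ (u , v)) (inj₂ (x , y)) = map′
    (λ { (refl , refl , p , m) → mid p m }) (λ { (mid p m) → refl , refl , p , m })
    ((u Fin.≟ y) ×-dec (v Fin.≟ x) ×-dec T? (adj u v) ×-dec (moved u v Boolₚ.≟ true))

  -- A `Graph` has its vertices in a `Fin`, while layouts are easier to build on `W`; this bijection
  -- carries them across in both directions.
  code : Fin (order + order * order) ↔ W
  code = (↔-id _ ⊎-↔ Finₚ.*↔×) ↔-∘ Finₚ.+↔⊎

  open Inverse code using (to; from; strictlyInverseˡ; strictlyInverseʳ)

  to-injective : Injective _≡_ _≡_ to
  to-injective {a} {b} eq =
    trans (sym (strictlyInverseʳ a)) (trans (cong from eq) (strictlyInverseʳ b))

  from-injective : Injective _≡_ _≡_ from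
  from-injective {a} {b} eq =
    trans (sym (strictlyInverseˡ a)) (trans (cong to eq) (strictlyInverseˡ b))

  subdivision : Graph
  subdivision = record
    { order       = order + order * order
    ; adj         = λ a b → does (subAdj? (to a) (to b))
    ; symmetric   = λ a b → does-⇔ (mk⇔ subAdj-sym subAdj-sym)
                                   (subAdj? (to a) (to b)) (subAdj? (to b) (to a))
    ; irreflexive = λ a → dec-false (subAdj? (to a) (to a)) (λ p → subAdj-≢ p refl)
    ; nonempty    = let _ , _ , p = nonempty ; a , b , q = subEdge p
                    in from a , from b , from-adj q
    }
    module AdjacencyTest where
    from-adj : ∀ {a b} → SubAdj a b → T (does (subAdj? (to (from a)) (to (from b))))
    from-adj {a} {b} p = Equivalence.from Boolₚ.T-≡
      (dec-true (subAdj? (to (from a)) (to (from b)))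
        (subst₂ SubAdj (sym (strictlyInverseˡ a)) (sym (strictlyInverseˡ b)) p))

    to-adj : ∀ {a b} → T (does (subAdj? (to a) (to b))) → SubAdj (to a) (to b)
    to-adj {a} {b} t with yes p ← subAdj? (to a) (to b) = p

    subEdge : ∀ {u v} → Adj G u v → ∃ λ a → ∃ λ b → SubAdj a b
    subEdge {u} {v} p with moved u v in m
    ... | true  = _ , _ , out p m
    ... | false = _ , _ , keep p m

  toSubdivision : ∀ {S Q} → Layout SubAdj S Q → Layout (Adj subdivision) S Q
  toSubdivision = pullback to to-injective AdjacencyTest.to-adj

  fromSubdivision : ∀ {S Q} → Layout (Adj subdivision) S Q → Layout SubAdj S Q
  fromSubdivision = pullback from from-injective AdjacencyTest.from-adj

  module Contraction {Q : Set} (L : Layout SubAdj (Fin 0) Q) where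
    open Layout L

    queueOf : W → W → Q
    queueOf a b = [ (λ ()) , id ] (colour a b)

    queueOf-colour : ∀ a b → colour a b ≡ inj₂ (queueOf a b)
    queueOf-colour a b with inj₂ _ ← colour a b = refl

    queueOf-sym : ∀ {a b} → SubAdj a b → queueOf a b ≡ queueOf b a
    queueOf-sym p = cong [ (λ ()) , id ] (colour-sym p)

    nest-free : ∀ {a b c d} → SubAdj a b → SubAdj c d → queueOf a b ≡ queueOf c d →
                a < c → c < d → d < b → ⊥
    nest-free p r eq = noNest p r (queueOf-colour _ _)
      (trans (queueOf-colour _ _) (cong inj₂ (sym eq)))

    step : W → W → Step Q
    step a b = does (a O.<? b) , queueOf a b

    -- Two edges of one queue that leave a < a′ in the same direction arrive in
    -- the same order, since otherwise they nest.
    step-monotone : ∀ {a b a′ b′} → SubAdj a b → SubAdj a′ b′ → step a b ≡ step a′ b′ →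
                    a < a′ → ¬ (b′ < b)
    step-monotone {a} {b} {a′} {b′} p p′ eq a<a′ b′<b with ,-injective eq
    ... | dir , queue with O.compare a b | a O.<? b | a′ O.<? b′
    ... | tri≈ _ a≡b _ | _     | _      = subAdj-≢ p a≡b
    ... | _            | yes _ | yes a′<b′ = nest-free p p′ queue a<a′ a′<b′ b′<b
    ... | tri< a<b _ _ | no a≮b | _ = a≮b a<b
    ... | tri> _ _ b<a | no _  | no a′≮b′ =
      nest-free (subAdj-sym p′) (subAdj-sym p)
        (trans (sym (queueOf-sym p′)) (trans (sym queue) (queueOf-sym p)))
        b′<b b<a a<a′

    path : Vertex → Vertex → Step Q × Step Q × Step Q
    path u v = step (inj₁ u) (inj₂ (u , v)) ,
               step (inj₂ (u , v)) (inj₂ (v , u)) ,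
               step (inj₂ (v , u)) (inj₁ v)

    step-strict : ∀ {a b a′ b′} → SubAdj a b → SubAdj a′ b′ → step a b ≡ step a′ b′ →
                  b ≢ b′ → a < a′ → b < b′
    step-strict {b = b} {b′ = b′} p p′ eq b≢b′ a<a′ with O.compare b b′
    ... | tri< b<b′ _ _ = b<b′
    ... | tri≈ _ b≡b′ _ = contradiction b≡b′ b≢b′
    ... | tri> _ _ b′<b = contradiction b′<b (step-monotone p p′ eq a<a′)

    -- The order of the starting vertices travels along the paths. It stays strict at the division
    -- vertices, which differ because they record `u` and `u′`, and becomes weak at the far ends,
    -- which may coincide. This is exactly what forbids nesting.
    path-monotone : ∀ {u v u′ v′} → Adj G u v → Adj G u′ v′ →
                    moved u v ≡ true → moved u′ v′ ≡ true → path u v ≡ path u′ v′ →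
                    inj₁ u < inj₁ u′ → ¬ (inj₁ v′ < inj₁ v)
    path-monotone p p′ m m′ eq u<u′ =
      let e₁ , eq′ = ,-injective eq
          e₂ , e₃  = ,-injective eq′
          u≢u′     = λ u≡u′ → O.irrefl (cong inj₁ u≡u′) u<u′
          x<x′     = step-strict (out p m) (out p′ m′) e₁
                       (u≢u′ ∘ cong proj₁ ∘ inj₂-injective) u<u′
          y<y′     = step-strict (mid p m) (mid p′ m′) e₂
                       (u≢u′ ∘ cong proj₂ ∘ inj₂-injective) x<x′
      in step-monotone (back (adjacent-sym G p) (trans (sym (moved-sym p)) m))
                       (back (adjacent-sym G p′) (trans (sym (moved-sym p′)) m′)) e₃ y<y′

    -- Reading every path from its smaller end makes the colour symmetric, and two nested edges are
    -- then both read from left to right, as `path-monotone` requires.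
    upward : Vertex → Vertex → Step Q × Step Q × Step Q
    upward u v = if does (inj₁ u O.<? inj₁ v) then path u v else path v u

    upward-< : ∀ {u v} → inj₁ u < inj₁ v → upward u v ≡ path u v
    upward-< {u} {v} u<v rewrite dec-true (inj₁ u O.<? inj₁ v) u<v = refl

    upward-> : ∀ {u v} → inj₁ v < inj₁ u → upward u v ≡ path v u
    upward-> {u} {v} v<u rewrite dec-false (inj₁ u O.<? inj₁ v) (O.asym v<u) = refl

    upward-sym : ∀ {u v} → u ≢ v → upward u v ≡ upward v u
    upward-sym {u} {v} u≢v = cases (O.compare (inj₁ u) (inj₁ v))
      where
      cases : Tri (inj₁ u < inj₁ v) (inj₁ u ≡ inj₁ v) (inj₁ v < inj₁ u) →
              upward u v ≡ upward v u
      cases (tri< u<v _ _) = trans (upward-< u<v) (sym (upward-> u<v))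
      cases (tri≈ _ u≡v _) = contradiction (inj₁-injective u≡v) u≢v
      cases (tri> _ _ v<u) = trans (upward-> v<u) (sym (upward-< v<u))

    contracted : Layout (Adj G) (Fin 0) (Q ⊎ Step Q × Step Q × Step Q)
    contracted = record
      { _<_                = λ u v → inj₁ u < inj₁ v
      ; isStrictTotalOrder =
          isStrictTotalOrder-on inj₁ (cong inj₁) inj₁-injective isStrictTotalOrder
      ; colour             = λ u v → inj₂ (colour′ u v)
      ; colour-sym         = λ p → cong inj₂ (colour′-sym p)
      ; noCross            = λ _ _ ()
      ; noNest             = λ p r k l → noNest′ p r (inj₂-injective (trans k (sym l)))
      }
      where
      colour′ : Vertex → Vertex → Q ⊎ Step Q × Step Q × Step Q
      colour′ u v = if moved u v then inj₂ (upward u v) else inj₁ (queueOf (inj₁ u) (inj₁ v))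

      colour′-sym : ∀ {u v} → Adj G u v → colour′ u v ≡ colour′ v u
      colour′-sym {u} {v} p rewrite sym (moved-sym p) with moved u v in m
      ... | true  = cong inj₂ (upward-sym (adjacent-≢ G p))
      ... | false = cong inj₁ (queueOf-sym (keep p m))

      noNest′ : ∀ {u v x y} → Adj G u v → Adj G x y → colour′ u v ≡ colour′ x y →
                inj₁ u < inj₁ x → inj₁ x < inj₁ y → inj₁ y < inj₁ v → ⊥
      noNest′ {u} {v} {x} {y} p r eq u<x x<y y<v with moved u v in m | moved x y in n
      ... | false | false = nest-free (keep p m) (keep r n) (inj₁-injective eq) u<x x<y y<v
      ... | true  | true  = path-monotone p r m n
        (trans (sym (upward-< (O.trans u<x (O.trans x<y y<v))))
               (trans (inj₂-injective eq) (upward-< x<y)))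
        u<x y<v

  qn-≤-subdivision : ∀ {C} → qn subdivision ≤ C → qn G ≤ contractedQueues C
  qn-≤-subdivision {C} qn≤C = qn-≤ G
    (recolour id Code.from id
      (λ {a} {b} eq → trans (sym (Code.strictlyInverseˡ a))
                            (trans (cong Code.to eq) (Code.strictlyInverseˡ b)))
      (Contraction.contracted (fromSubdivision (queueLayout subdivision qn≤C))))
    where
    code₁ : Fin (2 * C) ↔ Step (Fin C)
    code₁ = (Finₚ.2↔Bool ×-↔ ↔-id _) ↔-∘ Finₚ.*↔×

    module Code = Inverse
      ((↔-id (Fin C) ⊎-↔ ((code₁ ×-↔ ((code₁ ×-↔ code₁) ↔-∘ Finₚ.*↔×)) ↔-∘ Finₚ.*↔×)) ↔-∘ Finₚ.+↔⊎)

-- Orders on the vertices of a subdivision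

module BlockOrder {V P : Set} (_≺_ : Rel V 0ℓ) (_⊏_ : Rel P 0ℓ) (right : P → Bool) where

  infix 4 _<_
  -- The ordinal sum of three orders: the left block of `P`, then `V`, then the right block of `P`.
  data _<_ : Rel (V ⊎ P) 0ℓ where
    vv : ∀ {u v} → u ≺ v → inj₁ u < inj₁ v
    hh : ∀ {p r} → right p ≡ right r → p ⊏ r → inj₂ p < inj₂ r
    hv : ∀ {p u} → right p ≡ false → inj₂ p < inj₁ u
    vh : ∀ {u p} → right p ≡ true → inj₁ u < inj₂ p
    lr : ∀ {p r} → right p ≡ false → right r ≡ true → inj₂ p < inj₂ r

  clash : ∀ {b} → b ≡ true → b ≡ false → ⊥
  clash refl ()

  blockOrder : IsStrictTotalOrder _≡_ _≺_ → IsStrictTotalOrder _≡_ _⊏_ →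
               IsStrictTotalOrder _≡_ _<_
  blockOrder V< P< = isStrictTotalOrderᶜ record
    { isEquivalence = isEquivalence
    ; trans         = <-trans
    ; compare       = cmp
    }
    where
    module V = IsStrictTotalOrder V<
    module P = IsStrictTotalOrder P<

    <-trans : Transitive _<_
    <-trans (vv p)   (vv q)   = vv (V.trans p q)
    <-trans (vv p)   (vh r)   = vh r
    <-trans (hh e p) (hh f q) = hh (trans e f) (P.trans p q)
    <-trans (hh e p) (hv l)   = hv (trans e l)
    <-trans (hh e p) (lr l r) = lr (trans e l) r
    <-trans (hv l)   (vv p)   = hv l
    <-trans (hv l)   (vh r)   = lr l r
    <-trans (vh r)   (hh e p) = vh (trans (sym e) r)
    <-trans (vh r)   (hv l)   = ⊥-elim (clash r l)
    <-trans (vh r)   (lr l _) = ⊥-elim (clash r l)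
    <-trans (lr l r) (hh e p) = lr l (trans (sym e) r)
    <-trans (lr l r) (hv l′)  = ⊥-elim (clash r l′)
    <-trans (lr l r) (lr l′ _) = ⊥-elim (clash r l′)

    cmp : Trichotomous _≡_ _<_
    cmp (inj₁ u) (inj₁ v) with V.compare u v
    ... | tri< p q r = tri< (vv p) (q ∘ inj₁-injective) λ { (vv x) → r x }
    ... | tri≈ p q r = tri≈ (λ { (vv x) → p x }) (cong inj₁ q) λ { (vv x) → r x }
    ... | tri> p q r = tri> (λ { (vv x) → p x }) (q ∘ inj₁-injective) (vv r)
    cmp (inj₁ u) (inj₂ p) with right p in e
    ... | true  = tri< (vh e) (λ ()) λ { (hv l) → clash e l }
    ... | false = tri> (λ { (vh r) → clash r e }) (λ ()) (hv e)
    cmp (inj₂ p) (inj₁ u) with right p in e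
    ... | true  = tri> (λ { (hv l) → clash e l }) (λ ()) (vh e)
    ... | false = tri< (hv e) (λ ()) λ { (vh r) → clash r e }
    cmp (inj₂ p) (inj₂ r) with right p in e | right r in f
    ... | true  | false = tri> (λ { (hh eq _) → clash (trans (sym eq) e) f ; (lr l _) → clash e l })
                               (λ { refl → clash e f }) (lr f e)
    ... | false | true  = tri< (lr e f) (λ { refl → clash f e })
                               λ { (hh eq _) → clash (trans (sym eq) f) e ; (lr l _) → clash f l }
    ... | true  | true  with P.compare p r
    ...   | tri< a b c = tri< (hh (trans e (sym f)) a) (b ∘ inj₂-injective)
                              λ { (hh _ x) → c x ; (lr l _) → clash f l }
    ...   | tri≈ a b c = tri≈ (λ { (hh _ x) → a x ; (lr l _) → clash e l }) (cong inj₂ b)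
                              λ { (hh _ x) → c x ; (lr l _) → clash f l }
    ...   | tri> a b c = tri> (λ { (hh _ x) → a x ; (lr l _) → clash e l }) (b ∘ inj₂-injective)
                              (hh (trans f (sym e)) c)
    cmp (inj₂ p) (inj₂ r) | false | false with P.compare p r
    ...   | tri< a b c = tri< (hh (trans e (sym f)) a) (b ∘ inj₂-injective)
                              λ { (hh _ x) → c x ; (lr _ l) → clash l e }
    ...   | tri≈ a b c = tri≈ (λ { (hh _ x) → a x ; (lr _ l) → clash l f }) (cong inj₂ b)
                              λ { (hh _ x) → c x ; (lr _ l) → clash l e }
    ...   | tri> a b c = tri> (λ { (hh _ x) → a x ; (lr _ l) → clash l f }) (b ∘ inj₂-injective)
                              (hh (trans f (sym e)) c)

-- The pair (u , v) stands for the division vertex of the edge uv next to u.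
module DivisionOrders {V : Set} {_≺_ : Rel V 0ℓ} (≺-sto : IsStrictTotalOrder _≡_ _≺_) where
  private module O = IsStrictTotalOrder ≺-sto

  infix 4 _⊏ₛ_ _<ₗ_ _⊏ₑ_

  upwards : V → V → Bool
  upwards u v = does (u O.<? v)

  upwards-true : ∀ {u v} → u ≺ v → upwards u v ≡ true
  upwards-true {u} {v} = dec-true (u O.<? v)

  upwards-false : ∀ {u v} → v ≺ u → upwards u v ≡ false
  upwards-false {u} {v} = dec-false (u O.<? v) ∘ O.asym

  -- Around u, the other ends run cyclically downwards, from just below u to
  -- just above it: this unfolds non-crossing arcs into non-crossing arcs.
  _⊏ₛ_ : Rel (V × V) 0ℓ
  (u , v) ⊏ₛ (x , y) = ×-Lex _≡_ _≺_ (×-Lex _≡_ Bool._<_ (flip _≺_))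
    (u , upwards u v , v) (x , upwards x y , y)

  stackOrder : IsStrictTotalOrder _≡_ _⊏ₛ_
  stackOrder = isStrictTotalOrder-on {_≈_ = Pointwise _≡_ (Pointwise _≡_ _≡_)}
    (λ (u , v) → u , upwards u v , v)
    (λ { refl → refl , refl , refl }) (λ { (refl , _ , refl) → refl })
    (×-isStrictTotalOrder ≺-sto
      (×-isStrictTotalOrder Boolₚ.<-isStrictTotalOrder (Flip.isStrictTotalOrder ≺-sto)))

  ⊏ₛ-source : ∀ {u v x y} → (u , v) ⊏ₛ (x , y) → ¬ (x ≺ u)
  ⊏ₛ-source (inj₁ u≺x)        = O.asym u≺x
  ⊏ₛ-source (inj₂ (refl , _)) = O.irrefl refl

  ⊏ₛ-above : ∀ {u v y} → u ≺ v → u ≺ y → (u , v) ⊏ₛ (u , y) → y ≺ v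
  ⊏ₛ-above u≺v u≺y (inj₁ u≺u) = ⊥-elim (O.irrefl refl u≺u)
  ⊏ₛ-above {u} {v} {y} u≺v u≺y (inj₂ (_ , inj₁ lt))
    rewrite upwards-true u≺v | upwards-true u≺y with () ← lt
  ⊏ₛ-above u≺v u≺y (inj₂ (_ , inj₂ (_ , y≺v))) = y≺v

  ⊏ₛ-below : ∀ {u v y} → v ≺ u → y ≺ u → (u , v) ⊏ₛ (u , y) → y ≺ v
  ⊏ₛ-below v≺u y≺u (inj₁ u≺u) = ⊥-elim (O.irrefl refl u≺u)
  ⊏ₛ-below {u} {v} {y} v≺u y≺u (inj₂ (_ , inj₁ lt))
    rewrite upwards-false v≺u | upwards-false y≺u with () ← lt
  ⊏ₛ-below v≺u y≺u (inj₂ (_ , inj₂ (_ , y≺v))) = y≺v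

  ⊏ₛ-through : ∀ {u v y} → v ≺ u → u ≺ y → ¬ ((u , y) ⊏ₛ (u , v))
  ⊏ₛ-through v≺u u≺y (inj₁ u≺u) = O.irrefl refl u≺u
  ⊏ₛ-through v≺u u≺y (inj₂ (_ , inj₁ lt))
    rewrite upwards-false v≺u | upwards-true u≺y with () ← lt
  ⊏ₛ-through v≺u u≺y (inj₂ (_ , inj₂ (eq , _)))
    with () ← trans (sym (upwards-true u≺y)) (trans eq (upwards-false v≺u))

  ⊏ₛ-source-≼ : ∀ {u v x y} → (u , v) ⊏ₛ (x , y) → u ≺ x ⊎ u ≡ x
  ⊏ₛ-source-≼ = Sum.map₂ proj₁

  -- The first components increase weakly along the chain, and a strict increase throughout is a
  -- crossing. Two adjacent equalities would make one of the edges a loop. In the other cases the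
  -- edges share an end, and the cyclic order of the other ends around it contradicts the chain.
  ⊏ₛ-cross : ∀ {u v x y} → u ≢ v → x ≢ y →
             (u , v) ⊏ₛ (x , y) → (x , y) ⊏ₛ (v , u) → (v , u) ⊏ₛ (y , x) →
             u ≺ x × x ≺ v × v ≺ y
  ⊏ₛ-cross u≢v x≢y p q r with ⊏ₛ-source-≼ p | ⊏ₛ-source-≼ q | ⊏ₛ-source-≼ r
  ... | inj₁ u≺x  | inj₁ x≺v  | inj₁ v≺y  = u≺x , x≺v , v≺y
  ... | inj₂ refl | inj₂ refl | _         = contradiction refl u≢v
  ... | _         | inj₂ refl | inj₂ refl = contradiction refl x≢y
  ... | inj₂ refl | inj₁ u≺v  | inj₁ v≺y  =
    ⊥-elim (O.asym v≺y (⊏ₛ-above u≺v (O.trans u≺v v≺y) p))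
  ... | inj₂ refl | inj₁ u≺v  | inj₂ refl = ⊥-elim (O.irrefl refl (⊏ₛ-above u≺v u≺v p))
  ... | inj₁ u≺x  | inj₂ refl | inj₁ x≺y  = ⊥-elim (⊏ₛ-through u≺x x≺y q)
  ... | inj₁ u≺x  | inj₁ x≺v  | inj₂ refl =
    ⊥-elim (O.asym u≺x (⊏ₛ-below (O.trans u≺x x≺v) x≺v r))

  -- The Boolean only separates the two division vertices of one edge; as `false` precedes `true`,
  -- the one next to the larger end comes first.
  endsKey : V × V → V × V × Bool
  endsKey (u , v) = if upwards u v then (u , v , true) else (v , u , false)

  endsKey-≺ : ∀ {u v} → u ≺ v → endsKey (u , v) ≡ (u , v , true)
  endsKey-≺ u≺v rewrite upwards-true u≺v = refl

  endsKey-≻ : ∀ {u v} → v ≺ u → endsKey (u , v) ≡ (v , u , false)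
  endsKey-≻ v≺u rewrite upwards-false v≺u = refl

  endsKey-injective : ∀ {p r} → Pointwise _≡_ (Pointwise _≡_ _≡_) (endsKey p) (endsKey r) → p ≡ r
  endsKey-injective {u , v} {x , y} eq with upwards u v | upwards x y
  ... | true  | true  with refl , refl , _ ← eq = refl
  ... | false | false with refl , refl , _ ← eq = refl
  ... | true  | false with _ , _ , () ← eq
  ... | false | true  with _ , _ , () ← eq

  _<ₗ_ : Rel (V × V × Bool) 0ℓ
  _<ₗ_ = ×-Lex _≡_ _≺_ (×-Lex _≡_ _≺_ Bool._<_)

  -- Ordering edges by their smaller, then larger end keeps the two division
  -- vertices of an edge consecutive.
  _⊏ₑ_ : Rel (V × V) 0ℓ
  p ⊏ₑ r = endsKey p <ₗ endsKey r

  edgeOrder : IsStrictTotalOrder _≡_ _⊏ₑ_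
  edgeOrder = isStrictTotalOrder-on {_≈_ = Pointwise _≡_ (Pointwise _≡_ _≡_)} endsKey
    (λ { refl → refl , refl , refl }) endsKey-injective
    (×-isStrictTotalOrder ≺-sto (×-isStrictTotalOrder ≺-sto Boolₚ.<-isStrictTotalOrder))

  -- A key strictly between would have to agree in the first two components, leaving three strictly
  -- increasing Booleans.
  lex-no-between : ∀ {u v b c k} → (u , v , b) <ₗ k → ¬ (k <ₗ (u , v , c))
  lex-no-between (inj₁ u≺x) (inj₁ x≺u) = O.asym u≺x x≺u
  lex-no-between (inj₁ u≺x) (inj₂ (refl , _)) = O.irrefl refl u≺x
  lex-no-between (inj₂ (refl , _)) (inj₁ u≺u) = O.irrefl refl u≺u
  lex-no-between (inj₂ (_ , inj₁ v≺y)) (inj₂ (_ , inj₁ y≺v)) = O.asym v≺y y≺v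
  lex-no-between (inj₂ (_ , inj₁ v≺y)) (inj₂ (_ , inj₂ (refl , _))) = O.irrefl refl v≺y
  lex-no-between (inj₂ (_ , inj₂ (refl , _))) (inj₂ (_ , inj₁ v≺v)) = O.irrefl refl v≺v
  lex-no-between (inj₂ (_ , inj₂ (_ , Bool.f<t))) (inj₂ (_ , inj₂ (_ , ())))

  ⊏ₑ-consecutive : ∀ {u v x y} → u ≢ v → (u , v) ⊏ₑ (x , y) → ¬ ((x , y) ⊏ₑ (v , u))
  ⊏ₑ-consecutive {u} {v} u≢v p q with O.compare u v
  ... | tri≈ _ u≡v _ = u≢v u≡v
  ... | tri< u≺v _ _ rewrite endsKey-≻ u≺v = lex-no-between p q
  ... | tri> _ _ v≺u rewrite endsKey-≺ v≺u = lex-no-between p q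

  ⊏ₑ-min : ∀ {u v x y} → u ≺ v → x ≺ y → (x , y) ⊏ₑ (u , v) → ¬ (u ≺ x)
  ⊏ₑ-min u≺v x≺y p u≺x rewrite endsKey-≺ u≺v | endsKey-≺ x≺y with p
  ... | inj₁ x≺u        = O.asym u≺x x≺u
  ... | inj₂ (refl , _) = O.irrefl refl u≺x

  -- Here `u` and `x` are the larger ends. Their order is opposite to that of the keys, so the
  -- smaller ends must decide the latter. Hence the edge `uv` lies strictly inside `xy`, which a
  -- queue will exclude.
  ⊏ₑ-max : ∀ {u v x y} → v ≺ u → y ≺ x → (x , y) ⊏ₑ (u , v) → u ≺ x → y ≺ v
  ⊏ₑ-max v≺u y≺x p u≺x rewrite endsKey-≻ v≺u | endsKey-≻ y≺x with p
  ... | inj₁ y≺v                     = y≺v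
  ... | inj₂ (_ , inj₁ x≺u)          = ⊥-elim (O.asym u≺x x≺u)
  ... | inj₂ (_ , inj₂ (refl , _))   = ⊥-elim (O.irrefl refl u≺x)

-- Laying out subdivisions by rerouting edges through blocks

QueueNumber≤ : ℕ → Set → Set → Set₁
QueueNumber≤ C S Q = ∀ G → Layout (Adj G) S Q → qn G ≤ C

-- A layout of the subdivision whose division vertices lie in two blocks, left
-- and right of the original vertices.  κ colours the kept edges, τ the edges
-- joining an original vertex to a division vertex, and μ the middle edges of
-- the subdivided edges; all middle edges are in stacks.
module Rerouting {G : Graph} {S Q S′ Q′ : Set} (L : Layout (Adj G) S Q)
  (moves right : S ⊎ Q → Bool)
  (κ : S ⊎ Q → S′ ⊎ Q′) (τ : Graph.Vertex G → Graph.Vertex G → S′ ⊎ Q′) (μ : S ⊎ Q → S′)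
  (_⊏_ : Rel (Graph.Vertex G × Graph.Vertex G) 0ℓ) where

  open Graph G
  open Layout L using (colour; colour-sym; noCross; noNest)
    renaming (_<_ to _≺_; isStrictTotalOrder to ≺-isStrictTotalOrder)

  Moved : Rel Vertex 0ℓ
  Moved u v = Adj G u v × moves (colour u v) ≡ true

  open Subdivision G (λ u v → moves (colour u v)) (cong moves ∘ colour-sym) public
    using (W; SubAdj; keep; out; back; mid; subdivision; qn-≤-subdivision; toSubdivision)

  rightOf : Vertex × Vertex → Bool
  rightOf (u , v) = right (colour u v)

  open BlockOrder _≺_ _⊏_ rightOf

  -- The positions of the blocks rule out most crossings and nestings. Those that remain and involve
  -- a subdivided edge are excluded by the fields from `κ≢τ` on. By `τ-right`, a stack never carries
  -- edges to the left block, so `τ-stack` and `τ-μ` only have to describe the right one.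
  record Admissible : Set where
    field
      ⊏-isStrictTotalOrder : IsStrictTotalOrder _≡_ _⊏_
      κ-stack : ∀ {k l i} → moves k ≡ false → moves l ≡ false → κ k ≡ inj₁ i → κ l ≡ inj₁ i →
                ∃ λ j → k ≡ inj₁ j × l ≡ inj₁ j
      κ-queue : ∀ {k l i} → moves k ≡ false → moves l ≡ false → κ k ≡ inj₂ i → κ l ≡ inj₂ i →
                ∃ λ j → k ≡ inj₂ j × l ≡ inj₂ j
      κ≢τ     : ∀ {k u v c} → moves k ≡ false → κ k ≡ c → τ u v ≡ c → ⊥
      τ-right : ∀ {u v i} → Moved u v → τ u v ≡ inj₁ i → rightOf (u , v) ≡ true
      τ-stack : ∀ {u v x y i} → Moved u v → Moved x y → τ u v ≡ inj₁ i → τ x y ≡ inj₁ i →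
                u ≺ x → (u , v) ⊏ (x , y) → ⊥
      τ-queue : ∀ {u v x y j} → Moved u v → Moved x y → τ u v ≡ inj₂ j → τ x y ≡ inj₂ j →
                u ≺ x → (x , y) ⊏ (u , v) → ⊥
      τ-μ     : ∀ {u v x y i} → Moved u v → Moved x y → τ u v ≡ inj₁ i → μ (colour x y) ≡ i →
                (x , y) ⊏ (u , v) → (u , v) ⊏ (y , x) → ⊥
      μ-stack : ∀ {u v x y} → Moved u v → Moved x y → μ (colour u v) ≡ μ (colour x y) →
                rightOf (u , v) ≡ rightOf (x , y) →
                (u , v) ⊏ (x , y) → (x , y) ⊏ (v , u) → (v , u) ⊏ (y , x) → ⊥

  rerouted : Admissible → Layout SubAdj S′ Q′
  rerouted adm = record
    { _<_                = _<_
    ; isStrictTotalOrder = blockOrder ≺-isStrictTotalOrder ⊏-isStrictTotalOrder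
    ; colour             = colour′
    ; colour-sym         = colour′-sym
    ; noCross            = noCross′
    ; noNest             = noNest′
    }
    where
    open Admissible adm

    colour′ : W → W → S′ ⊎ Q′
    colour′ (inj₁ u)       (inj₁ v)       = κ (colour u v)
    colour′ (inj₁ _)       (inj₂ (u , v)) = τ u v
    colour′ (inj₂ (u , v)) (inj₁ _)       = τ u v
    colour′ (inj₂ (u , v)) (inj₂ _)       = inj₁ (μ (colour u v))

    colour′-sym : ∀ {a b} → SubAdj a b → colour′ a b ≡ colour′ b a
    colour′-sym (keep p _) = cong κ (colour-sym p)
    colour′-sym (out _ _)  = refl
    colour′-sym (back _ _) = refl
    colour′-sym (mid p _)  = cong (inj₁ ∘ μ) (colour-sym p)

    sameSide : ∀ {u v} → Adj G u v → rightOf (u , v) ≡ rightOf (v , u)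
    sameSide = cong right ∘ colour-sym

    noCross′ : ∀ {a b c d i} → SubAdj a b → SubAdj c d →
               colour′ a b ≡ inj₁ i → colour′ c d ≡ inj₁ i → a < c → c < b → b < d → ⊥
    noCross′ (keep p m) (keep r n) k l (vv a) (vv b) (vv c) =
      let _ , k′ , l′ = κ-stack m n k l in noCross p r k′ l′ a b c
    noCross′ (keep _ m) (out _ _)  k l _ _ _ = κ≢τ m k l
    noCross′ (keep _ m) (back _ _) k l _ _ _ = κ≢τ m k l
    noCross′ (out _ _)  (keep _ n) k l _ _ _ = κ≢τ n l k
    noCross′ (back _ _) (keep _ n) k l _ _ _ = κ≢τ n l k
    -- A middle edge has both ends in the same block, on one side of all original vertices, so it
    -- crosses no kept edge and may share its stack.
    noCross′ (keep _ _) (mid _ _)  _ _ (vh r) (hv l) _ = clash r l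
    noCross′ (mid _ _)  (keep _ _) _ _ _ (vh r) (hv l) = clash r l
    noCross′ (out p m) (out r n) k l (vv a) _ (hh _ c) = τ-stack (p , m) (r , n) k l a c
    noCross′ (out _ _) (out _ _) _ _ _ (vh r) (lr l _) = clash r l
    noCross′ (out _ _) (back _ _) _ _ (vh r) (hh e _) (hv l) = clash r (trans e l)
    noCross′ (out _ _) (back _ _) _ _ (vh r) (lr l _) _ = clash r l
    noCross′ (back p m) (out _ _) k _ (hv l) _ _ = clash (τ-right (p , m) k) l
    noCross′ (back _ _) (back r n) _ l _ (hv left) _ = clash (τ-right (r , n) l) left
    noCross′ (out p m) (mid r n) k l (vh _) (hh _ b) (hh _ c) =
      τ-μ (p , m) (r , n) k (inj₁-injective l) b c
    noCross′ (out _ _) (mid _ _) _ _ (vh r) (lr l _) _ = clash r l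
    noCross′ (out _ _) (mid _ _) _ _ (vh r) (hh e _) (lr l _) = clash (trans (sym e) r) l
    noCross′ (back p m) (mid _ _) k _ (hh e _) (hv l) _ = clash (τ-right (p , m) k) (trans e l)
    noCross′ (back p m) (mid _ _) k _ (lr l _) _ _ = clash (τ-right (p , m) k) l
    noCross′ (mid p _) (out _ _) _ _ (hv l) (vh r) _ = clash r (trans (sym (sameSide p)) l)
    noCross′ (mid _ _) (back r n) _ k _ (hh e _) (hv l) = clash (τ-right (r , n) k) (trans e l)
    noCross′ (mid _ _) (back r n) _ k _ (lr l _) _ = clash (τ-right (r , n) k) l
    noCross′ (mid p m) (mid r n) k l (hh e a) (hh _ b) (hh _ c) =
      μ-stack (p , m) (r , n) (inj₁-injective (trans k (sym l))) e a b c
    noCross′ (mid p _) (mid _ _) _ _ (lr l r) (hh e _) _ =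
      clash r (trans e (trans (sym (sameSide p)) l))
    noCross′ (mid _ _) (mid _ _) _ _ (lr _ r) (lr l _) _ = clash r l
    noCross′ (mid p _) (mid _ _) _ _ (hh e _) (lr l r) _ =
      clash r (trans (sym (sameSide p)) (trans e l))
    noCross′ (mid _ _) (mid r _) _ _ (hh _ _) (hh e _) (lr l r′) =
      clash r′ (trans (sym (sameSide r)) (trans e l))

    noNest′ : ∀ {a b c d j} → SubAdj a b → SubAdj c d →
              colour′ a b ≡ inj₂ j → colour′ c d ≡ inj₂ j → a < c → c < d → d < b → ⊥
    noNest′ (keep p m) (keep r n) k l (vv a) (vv b) (vv c) =
      let _ , k′ , l′ = κ-queue m n k l in noNest p r k′ l′ a b c
    noNest′ (keep _ m) (out _ _)  k l _ _ _ = κ≢τ m k l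
    noNest′ (keep _ m) (back _ _) k l _ _ _ = κ≢τ m k l
    noNest′ (out _ _)  (keep _ n) k l _ _ _ = κ≢τ n l k
    noNest′ (back _ _) (keep _ n) k l _ _ _ = κ≢τ n l k
    noNest′ (out p m) (out r n) k l (vv a) _ (hh _ c) = τ-queue (p , m) (r , n) k l a c
    noNest′ (out _ _) (out _ _) _ _ _ (vh r) (lr l _) = clash r l
    noNest′ (out _ _) (back _ _) _ _ (vh r) (hv l) _ = clash r l
    noNest′ (back _ _) (out _ _) _ _ _ (vh r) (hv l) = clash r l
    -- On the left the division vertices come first, so the configuration excluded by `τ-queue`
    -- appears with the two edges exchanged.
    noNest′ (back p m) (back r n) k l (hh _ a) _ (vv c) = τ-queue (r , n) (p , m) l k c a
    noNest′ (back _ _) (back _ _) _ _ (lr _ r) (hv l) _ = clash r l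

  qn-≤-rerouted : Admissible → ∀ {C} → QueueNumber≤ C S′ Q′ → qn G ≤ contractedQueues C
  qn-≤-rerouted adm bound = qn-≤-subdivision (bound subdivision (toSubdivision (rerouted adm)))

-- The three trades of stacks and queues

module StackArcs (G : Graph) {S Q : Set} (L : Layout (Adj G) S Q) where
  open Layout L
  open DivisionOrders isStrictTotalOrder

  -- This supplies `μ-stack` for blocks in stack order: middle edges that come from one stack again
  -- form a stack.
  ⊏ₛ-noCross : ∀ {u v x y i} → Adj G u v → Adj G x y →
               colour u v ≡ inj₁ i → colour x y ≡ inj₁ i →
               (u , v) ⊏ₛ (x , y) → (x , y) ⊏ₛ (v , u) → (v , u) ⊏ₛ (y , x) → ⊥
  ⊏ₛ-noCross p r k l a b c =
    let u<x , x<v , v<y = ⊏ₛ-cross (adjacent-≢ G p) (adjacent-≢ G r) a b c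
    in noCross p r k l u<x x<v v<y

-- The edges of stacks 0 and 1 are carried to the right block by stack 0, which
-- reverses their ends there; being separate from the kept edges, their middle
-- parts can use stacks 1 and 2.
fewerStacks : ∀ {C s Q} → QueueNumber≤ C (Fin (3 + s)) Q →
              QueueNumber≤ (contractedQueues C) (Fin (4 + s)) Q
fewerStacks {s = s} {Q} bound G L = qn-≤-rerouted adm bound
  where
  open Layout L
  open DivisionOrders isStrictTotalOrder
  open StackArcs G L

  moves : Fin (4 + s) ⊎ Q → Bool
  moves (inj₁ zero)          = true
  moves (inj₁ (suc zero))    = true
  moves (inj₁ (suc (suc _))) = false
  moves (inj₂ _)             = false

  κ : Fin (4 + s) ⊎ Q → Fin (3 + s) ⊎ Q
  κ (inj₁ zero)          = inj₁ zero
  κ (inj₁ (suc zero))    = inj₁ zero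
  -- Stack 0 is reserved for the edges to the block, so the kept stacks start at 1 and share stacks
  -- 1 and 2 with the middle edges.
  κ (inj₁ (suc (suc i))) = inj₁ (suc i)
  κ (inj₂ j)             = inj₂ j

  μ : Fin (4 + s) ⊎ Q → Fin (3 + s)
  μ (inj₁ zero) = suc zero
  μ _           = suc (suc zero)

  open Rerouting L moves (λ _ → true) κ (λ _ _ → inj₁ zero) μ (flip _⊏ₛ_)

  κ-stack : ∀ {k l i} → moves k ≡ false → moves l ≡ false → κ k ≡ inj₁ i → κ l ≡ inj₁ i →
            ∃ λ j → k ≡ inj₁ j × l ≡ inj₁ j
  κ-stack {inj₁ (suc (suc i))} {inj₁ (suc (suc _))} _ _ refl refl = suc (suc i) , refl , refl

  κ-queue : ∀ {k l i} → moves k ≡ false → moves l ≡ false → κ k ≡ inj₂ i → κ l ≡ inj₂ i →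
            ∃ λ j → k ≡ inj₂ j × l ≡ inj₂ j
  κ-queue {inj₂ j} {inj₂ _} _ _ refl refl = j , refl , refl
  κ-queue {inj₁ (suc (suc _))} {inj₂ _} _ _ ()
  κ-queue {inj₂ _} {inj₁ (suc (suc _))} _ _ _ ()

  κ≢τ : ∀ {k c} → moves k ≡ false → κ k ≡ c → inj₁ zero ≡ c → ⊥
  κ≢τ {inj₁ (suc (suc _))} _ refl ()
  κ≢τ {inj₂ _} _ refl ()

  μ-same : ∀ {k l} → moves k ≡ true → moves l ≡ true → μ k ≡ μ l →
           ∃ λ j → k ≡ inj₁ j × l ≡ inj₁ j
  μ-same {inj₁ zero}       {inj₁ zero}       _ _ _ = zero , refl , refl
  μ-same {inj₁ (suc zero)} {inj₁ (suc zero)} _ _ _ = suc zero , refl , refl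

  μ≢0 : ∀ k → μ k ≢ zero
  μ≢0 (inj₁ zero)    ()
  μ≢0 (inj₁ (suc _)) ()
  μ≢0 (inj₂ _)       ()

  adm : Admissible
  adm = record
    { ⊏-isStrictTotalOrder = Flip.isStrictTotalOrder stackOrder
    ; κ-stack = κ-stack
    ; κ-queue = κ-queue
    ; κ≢τ     = λ {k} → κ≢τ {k}
    ; τ-right = λ _ _ → refl
    ; τ-stack = λ _ _ _ _ u<x p → ⊏ₛ-source p u<x
    ; τ-queue = λ _ _ ()
    ; τ-μ     = λ { {x = x} {y} _ _ refl μ≡0 _ _ → μ≢0 (colour x y) μ≡0 }
    -- Read backwards, the four division vertices are in the order `_⊏ₛ_`, with both edges traversed
    -- from their other ends.
    ; μ-stack = λ (p , m) (r , n) eq _ a b c →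
        let _ , k , l = μ-same m n eq
        in ⊏ₛ-noCross (adjacent-sym G r) (adjacent-sym G p)
             (trans (sym (colour-sym r)) l) (trans (sym (colour-sym p)) k) c b a
    }

-- The edges of stack 1 are carried to the right block and those of stack 2 to
-- the left block by a queue, preserving the order of their ends, so that all
-- three stacks become one.
threeStacks : ∀ {C} → QueueNumber≤ C (Fin 1) (Fin 1) →
              QueueNumber≤ (contractedQueues C) (Fin 3) (Fin 0)
threeStacks bound G L = qn-≤-rerouted adm bound
  where
  open Layout L
  open DivisionOrders isStrictTotalOrder
  open StackArcs G L

  moves : Fin 3 ⊎ Fin 0 → Bool
  moves (inj₁ zero)    = false
  moves (inj₁ (suc _)) = true

  right : Fin 3 ⊎ Fin 0 → Bool
  right (inj₁ (suc zero)) = true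
  right (inj₁ _)          = false

  open Rerouting {S′ = Fin 1} {Q′ = Fin 1} L moves right
    (λ _ → inj₁ zero) (λ _ _ → inj₂ zero) (λ _ → zero) _⊏ₛ_

  kept : ∀ {k l} → moves k ≡ false → moves l ≡ false → ∃ λ j → k ≡ inj₁ j × l ≡ inj₁ j
  kept {inj₁ zero} {inj₁ zero} _ _ = zero , refl , refl

  -- All middle edges lie in the only stack, so it is the block that tells which original stack they
  -- come from.
  right-same : ∀ {k l} → moves k ≡ true → moves l ≡ true → right k ≡ right l →
               ∃ λ j → k ≡ inj₁ j × l ≡ inj₁ j
  right-same {inj₁ (suc zero)}       {inj₁ (suc zero)}       _ _ _ = _ , refl , refl
  right-same {inj₁ (suc (suc zero))} {inj₁ (suc (suc zero))} _ _ _ = _ , refl , refl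

  adm : Admissible
  adm = record
    { ⊏-isStrictTotalOrder = stackOrder
    ; κ-stack = λ m n _ _ → kept m n
    ; κ-queue = λ _ _ ()
    ; κ≢τ     = λ { _ refl () }
    ; τ-right = λ _ ()
    ; τ-stack = λ _ _ ()
    ; τ-queue = λ _ _ _ _ u<x p → ⊏ₛ-source p u<x
    ; τ-μ     = λ _ _ ()
    ; μ-stack = λ (p , m) (r , n) _ same a b c →
        let _ , k , l = right-same m n same
        in ⊏ₛ-noCross p r k l a b c
    }

-- Without nesting, the edges of queue 0 are monotone in both ends, so placing
-- their division vertices in reverse edge order turns them into two stacks.
fewerQueues : ∀ {C s q} → QueueNumber≤ C (Fin (2 + s)) (Fin q) →
              QueueNumber≤ (contractedQueues C) (Fin s) (Fin (suc q))
fewerQueues {s = s} {q} bound G L = qn-≤-rerouted adm bound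
  where
  open Graph G using (Vertex)
  open Layout L
  open DivisionOrders isStrictTotalOrder

  moves : Fin s ⊎ Fin (suc q) → Bool
  moves (inj₂ zero) = true
  moves _           = false

  κ : Fin s ⊎ Fin (suc q) → Fin (2 + s) ⊎ Fin q
  κ (inj₁ i)       = inj₁ (suc (suc i))
  κ (inj₂ zero)    = inj₁ zero
  κ (inj₂ (suc j)) = inj₂ j

  -- The edges to the block are split by whether they leave the smaller or the larger end of their
  -- edge; each class becomes one stack.
  end : Bool → Fin (2 + s)
  end true  = zero
  end false = suc zero

  -- The middle edges can join stack 0 because each connects two consecutive division vertices.
  open Rerouting L moves (λ _ → true) κ (λ u v → inj₁ (end (upwards u v))) (λ _ → zero)
    (flip _⊏ₑ_)

  κ-stack : ∀ {k l i} → moves k ≡ false → moves l ≡ false → κ k ≡ inj₁ i → κ l ≡ inj₁ i →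
            ∃ λ j → k ≡ inj₁ j × l ≡ inj₁ j
  κ-stack {inj₁ i} {inj₁ _} _ _ refl refl = i , refl , refl
  κ-stack {inj₁ _} {inj₂ (suc _)} _ _ _ ()
  κ-stack {inj₂ (suc _)} {inj₁ _} _ _ ()

  κ-queue : ∀ {k l i} → moves k ≡ false → moves l ≡ false → κ k ≡ inj₂ i → κ l ≡ inj₂ i →
            ∃ λ j → k ≡ inj₂ j × l ≡ inj₂ j
  κ-queue {inj₂ (suc j)} {inj₂ (suc _)} _ _ refl refl = suc j , refl , refl

  κ≢τ : ∀ {k c} b → moves k ≡ false → κ k ≡ c → inj₁ (end b) ≡ c → ⊥
  κ≢τ {inj₁ _}       true  _ refl ()
  κ≢τ {inj₁ _}       false _ refl ()
  κ≢τ {inj₂ (suc _)} true  _ refl ()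
  κ≢τ {inj₂ (suc _)} false _ refl ()

  moved-colour : ∀ {k} → moves k ≡ true → k ≡ inj₂ zero
  moved-colour {inj₂ zero} _ = refl

  -- At smaller ends, the edge order already follows the ends. At larger ends, a violation would put
  -- `uv` inside `xy`, although both are in queue 0. In the mixed cases the stacks differ.
  same-end : ∀ {u v x y} → Moved u v → Moved x y →
             end (upwards u v) ≡ end (upwards x y) → u < x → (x , y) ⊏ₑ (u , v) → ⊥
  same-end {u} {v} {x} {y} (p , m) (r , n) eq u<x lt = cases (O.compare u v) (O.compare x y)
    where
    cases : Tri (u < v) (u ≡ v) (v < u) → Tri (x < y) (x ≡ y) (y < x) → ⊥
    cases (tri≈ _ u≡v _) _              = adjacent-≢ G p u≡v
    cases _              (tri≈ _ x≡y _) = adjacent-≢ G r x≡y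
    cases (tri< u<v _ _) (tri< x<y _ _) = ⊏ₑ-min u<v x<y lt u<x
    cases (tri> _ _ v<u) (tri> _ _ y<x) =
      noNest (adjacent-sym G r) (adjacent-sym G p)
        (trans (sym (colour-sym r)) (moved-colour n))
        (trans (sym (colour-sym p)) (moved-colour m))
        (⊏ₑ-max v<u y<x lt u<x) v<u u<x
    cases (tri< u<v _ _) (tri> _ _ y<x)
      with () ← trans (sym (cong end (upwards-true u<v))) (trans eq (cong end (upwards-false y<x)))
    cases (tri> _ _ v<u) (tri< x<y _ _)
      with () ← trans (sym (cong end (upwards-false v<u))) (trans eq (cong end (upwards-true x<y)))

  adm : Admissible
  adm = record
    { ⊏-isStrictTotalOrder = Flip.isStrictTotalOrder edgeOrder
    ; κ-stack = κ-stack
    ; κ-queue = κ-queue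
    ; κ≢τ     = λ {k} {u} {v} → κ≢τ {k} (upwards u v)
    ; τ-right = λ _ _ → refl
    ; τ-stack = λ {u} {v} {x} {y} p r k l →
        same-end p r (inj₁-injective (trans k (sym l)))
    ; τ-queue = λ _ _ ()
    ; τ-μ     = λ _ (r , _) _ _ a b → ⊏ₑ-consecutive (adjacent-≢ G r ∘ sym) b a
    ; μ-stack = λ (p , _) _ _ _ a b _ → ⊏ₑ-consecutive (adjacent-≢ G p ∘ sym) b a
    }

-- Iterating the trades and deducing the equivalences

Bounded : ℕ → ℕ → Set₁
Bounded s q = ∃ λ C → QueueNumber≤ C (Fin s) (Fin q)

moreStacks : Bounded 3 0 → ∀ s → Bounded (3 + s) 0
moreStacks b zero    = b
moreStacks b (suc s) = let C , bound = moreStacks b s in contractedQueues C , fewerStacks bound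

-- Each queue costs two more stacks, so the induction on `q` runs over all `s` at once.
moreQueues : Bounded 3 0 → ∀ s q → Bounded (3 + s) q
moreQueues b s zero    = moreStacks b s
moreQueues b s (suc q) =
  let C , bound = moreQueues b (2 + s) q in contractedQueues C , fewerQueues bound

all-bounded : Bounded 3 0 → ∀ s q → Bounded s q
all-bounded b s q =
  let C , bound = moreQueues b s q
  -- Three empty stacks are put in front, which covers the cases with `s` below 3.
  in C , λ G → bound G ∘ recolour (3 ↑ʳ_) id (λ {i} {j} → Finₚ.↑ʳ-injective 3 i j) id

fromThreeStacks : BoundedOn3StackGraphs → Bounded 3 0
fromThreeStacks (C , bound) = C , λ G L → bound G (toStack G (toStackQueue G L))

fromStackQueueGraphs : BoundedOn1Stack1QueueGraphs → Bounded 3 0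
fromStackQueueGraphs (C , bound) =
  contractedQueues C , threeStacks (λ G L → bound G (toStackQueue G L))

theorem4 : (BoundedOnStackGraphs ⇔ BoundedOn3StackGraphs)
    × (BoundedOn3StackGraphs ⇔ BoundedOn1Stack1QueueGraphs)
    × (BoundedOn1Stack1QueueGraphs ⇔ BoundedOnStackQueueGraphs)
theorem4 =
  -- Apart from the two specialisations, to `s = 3` and to `s = q = 1`, every implication passes
  -- through `Bounded 3 0`.
  mk⇔ (λ (f , bound) → f 3 , bound 3 (s≤s z≤n))
      (λ h → let b = all-bounded (fromThreeStacks h) in
        (λ s → proj₁ (b s 0)) ,
        λ s _ G L → proj₂ (b s 0) G (fromStackQueue G (fromStack G L))) ,
  mk⇔ (λ h → let C , bound = all-bounded (fromThreeStacks h) 1 1 in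
        C , λ G L → bound G (fromStackQueue G L))
      (λ h → let C , bound = fromStackQueueGraphs h in
        C , λ G L → bound G (fromStackQueue G (fromStack G L))) ,
  mk⇔ (λ h → let b = all-bounded (fromStackQueueGraphs h) in
        (λ s q → proj₁ (b s q)) ,
        λ s q _ _ G L → proj₂ (b s q) G (fromStackQueue G L))
      (λ (f , bound) → f 1 1 , bound 1 1 (s≤s z≤n) (s≤s z≤n))
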